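{- Let $\sigma$ and $\pi$ be permutations, and let $m_1=(\sigma,R_1)$ and $m_2=(\sigma,R_2)$ be mesh patterns with the same underlying classical pattern $\sigma$. Regard $\pi=(\pi,\emptyset)$ as a (dominating) classical pattern and assume $|\pi|\le|\sigma|+2$. Suppose there is a box $(a,b)\in[0,|\sigma|]\times[0,|\sigma|]$ such that: 1. $R_2=R_1\cup\{(a,b)\}$; and 2. at least one of the following four conditions holds (where $x,y$ range over $[0,|\sigma|]$): (a)(i) $\pi\preceq\sigma^{(a,b)_a}$, and $(a+1,b)\in G(\sigma)$, and the box $(a+1,b-1)\notin R_1$, and for all $x\ne a,a+1$: $(x,b-1)\in R_1\Rightarrow(x,b)\in R_1$, and for all $y\neq b-1,b$: $(a+1,y)\in R_1\Rightarrow(a,y)\in R_1$; (a)(ii) $\pi\preceq\sigma^{(a,b)_a}$, and $(a,b+1)\in G(\sigma)$, and the box $(a-1,b+1)\notin R_1$, and for all $x\ne a-1,a$: $(x,b+1)\in R_1\Rightarrow(x,b)\in R_1$, and for all $y\neq b,b+1$: $(a-1,y)\in R_1\Rightarrow(a,y)\in R_1$; (b)(i) $\pi\preceq\sigma^{(a,b)_d}$, and $(a+1,b+1)\in G(\sigma)$, and the box $(a+1,b+1)\notin R_1$, and for all $x\ne a,a+1$: $(x,b+1)\in R_1\Rightarrow(x,b)\in R_1$, and for all $y\neq b,b+1$: $(a+1,y)\in R_1\Rightarrow(a,y)\in R_1$; (b)(ii) $\pi\preceq\sigma^{(a,b)_d}$, and $(a,b)\in G(\sigma)$, and the box $(a-1,b-1)\notin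 R_1$, and for all $x\ne a-1,a$: $(x,b-1)\in R_1\Rightarrow(x,b)\in R_1$, and for all $y\neq b-1,b$: $(a-1,y)\in R_1\Rightarrow(a,y)\in R_1$. Then $m_1$ and $m_2$ are coincident under $\pi$, i.e. $\mathrm{Av}(\{\pi,m_1\})=\mathrm{Av}(\{\pi,m_2\})$.
   Context: Write $[n]=\{1,\dots,n\}$ and $[0,k]=\{0,1,\dots,k\}$. A permutation of length $n$ is a bijection of $[n]$, written in one-line notation; $|\sigma|$ is the length of $\sigma$ and $G(\sigma)=\{(i,\sigma(i)) : i\in[n]\}$ is its plot. For permutations, $\sigma\preceq\pi$ means that $\pi$ contains $\sigma$ as a classical pattern, i.e. some subsequence of $\pi$ is order isomorphic to $\sigma$. A mesh pattern of length $k$ is a pair $p=(\tau,R)$ with $\tau$ a permutation of length $k$ (the underlying classical pattern) and $R\subseteq[0,k]\times[0,k]$; the element $(i,j)$ of $[0,k]\times[0,k]$ denotes the unit box with lower left corner $(i,j)$. An occurrence of $p$ in a permutation $\pi$ of length $n$ is a subset $\omega\subseteq G(\pi)$ for which there are order-preserving injections $\alpha,\beta:[k]\to[n]$ such that (i) $\omega=\{(\alpha(i),\beta(j)):(i,j)\in G(\tau)\}$, and (ii) with $\alpha(0)=\beta(0)=0$, $\alpha(k+1)=\beta(k+1)=n+1$ and $R_{ij}=[\alpha(i)+1,\alpha(i+1)-1]\times[\beta(j)+1,\beta(j+1)-1]$, one has $R_{ij}\cap G(\pi)=\emptyset$ for every $(i,j)\in R$. A permutation contains $p$ if it has an occurrence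 of $p$, and avoids $p$ otherwise. A classical pattern $\pi$ is identified with the mesh pattern $(\pi,\emptyset)$. $\mathrm{Av}(S)$ is the set of all permutations (of all lengths) avoiding every pattern in $S$. Two mesh patterns $p_1,p_2$ are coincident under $\pi$ if $\mathrm{Av}(\{\pi,p_1\})=\mathrm{Av}(\{\pi,p_2\})$. For a permutation $\sigma$ of length $n$ and a box $(a,b)\in[0,n]^2$, $\sigma^{(a,b)_a}$ (respectively $\sigma^{(a,b)_d}$) has as underlying permutation the permutation $\sigma'$ of length $n+2$ obtained by inserting an ascent (respectively a descent) in the box $(a,b)$: $\sigma'(a+1)=b+1,\ \sigma'(a+2)=b+2$ (respectively $\sigma'(a+1)=b+2,\ \sigma'(a+2)=b+1$); for $k\le a$, $\sigma'(k)=\sigma(k)$ if $\sigma(k)\le b$ and $\sigma(k)+2$ otherwise; for $k>a+2$, $\sigma'(k)=\sigma(k-2)$ if $\sigma(k-2)\le b$ and $\sigma(k-2)+2$ otherwise. Since $\pi$ is classical, $\pi\preceq\sigma^{(a,b)_a}$ (or $\sigma^{(a,b)_d}$) means that this underlying permutation contains $\pi$ classically. (Subscripts $a$, $d$ on a box stand for "ascent", "descent" and are unrelated to the coordinate $a$.) -}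

module Defs where

open import Data.Fin.Base using (Fin; zero; suc; toℕ; inject₁; _≤_; _<_)
open import Data.Fin.Permutation using (Permutation′; _⟨$⟩ʳ_; insert)
open import Data.Fin.Relation.Unary.Top using (view; ‵fromℕ; ‵inject₁)
open import Data.Nat.Base as ℕ using (ℕ)
open import Data.Product.Base using (∃; ∃₂; _×_; _,_)
open import Function.Base using (_∘_)
open import Function.Bundles using (_⇔_)
open import Function.Definitions using (Injective)
open import Level using (Level; 0ℓ; _⊔_) renaming (suc to lsuc)
open import Relation.Binary.Core using (_Preserves_⟶_)
open import Relation.Binary.PropositionalEquality.Core using (_≡_; _≢_)
open import Relation.Nullary.Negation.Core using (¬_)
open import Relation.Unary using (Pred; _∈_; _∉_; _⊆_; _≐_; ∅; Empty; ｛_｝; _∪_; _∩_)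

-- Conventions.  A permutation of length n is a bijection of Fin n, so
-- the element i : Fin n stands for the number toℕ i + 1 of [n].  An
-- element of [0,k] is an element of Fin (suc k), standing for itself.
-- Hence, for i : Fin k standing for the number c = toℕ i + 1, the
-- elements inject₁ i and suc i of Fin (suc k) are c - 1 and c.

private
  variable
    k l n : ℕ
    ℓ : Level

Plot : Permutation′ n → Pred (Fin n × Fin n) 0ℓ
Plot σ (i , j) = σ ⟨$⟩ʳ i ≡ j

OrderPreservingInjection : (Fin k → Fin n) → Set
OrderPreservingInjection f = Injective _≡_ _≡_ f × f Preserves _≤_ ⟶ _≤_

-- Classical containment: f selects the positions of a subsequence of π
-- that is order isomorphic to σ.
infix 4 _⪯_
_⪯_ : Permutation′ k → Permutation′ n → Set
_⪯_ {k} {n} σ π =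
  ∃ λ (f : Fin k → Fin n) →
    OrderPreservingInjection f ×
    (∀ i j → (σ ⟨$⟩ʳ i < σ ⟨$⟩ʳ j) ⇔ (π ⟨$⟩ʳ f i < π ⟨$⟩ʳ f j))

-- (i , j) is the unit box with lower left corner (i , j).
Box : ℕ → Set
Box k = Fin (ℕ.suc k) × Fin (ℕ.suc k)

record MeshPattern (k : ℕ) : Set₁ where
  constructor mesh
  field
    underlying : Permutation′ k
    shading    : Pred (Box k) 0ℓ

open MeshPattern public

classical : Permutation′ k → MeshPattern k
classical π = mesh π ∅

-- α on {0,…,k+1} with values in {0,…,n+1}, where α(0) = 0 and
-- α(k+1) = n+1; the successor on α j converts to values in [n].
extend : (Fin k → Fin n) → Fin (2 ℕ.+ k) → ℕ
extend         α zero    = 0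
extend {n = n} α (suc i) with view i
... | ‵fromℕ     = ℕ.suc n
... | ‵inject₁ j = ℕ.suc (toℕ (α j))

-- [α(i)+1, α(i+1)-1]
Strip : (Fin k → Fin n) → Fin (ℕ.suc k) → Pred (Fin n) 0ℓ
Strip α i x =
  extend α (inject₁ i) ℕ.< ℕ.suc (toℕ x) × ℕ.suc (toℕ x) ℕ.< extend α (suc i)

Region : (α β : Fin k → Fin n) → Box k → Pred (Fin n × Fin n) 0ℓ
Region α β (i , j) (x , y) = x ∈ Strip α i × y ∈ Strip β j

PlotImage : Permutation′ k → (α β : Fin k → Fin n) → Pred (Fin n × Fin n) 0ℓ
PlotImage τ α β q = ∃₂ λ i j → (i , j) ∈ Plot τ × q ≡ (α i , β j)

IsOccurrence : MeshPattern k → Permutation′ n → Pred (Fin n × Fin n) 0ℓ → Set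
IsOccurrence {k} {n} p π ω =
  ω ⊆ Plot π ×
  (∃₂ λ (α β : Fin k → Fin n) →
    OrderPreservingInjection α ×
    OrderPreservingInjection β ×
    ω ≐ PlotImage (underlying p) α β ×
    (∀ {c} → c ∈ shading p → Empty (Region α β c ∩ Plot π)))

Contains : Permutation′ n → MeshPattern k → Set₁
Contains π p = ∃ λ ω → IsOccurrence p π ω

Avoids : Permutation′ n → MeshPattern k → Set₁
Avoids π p = ¬ Contains π p

Av : Pred (∃ MeshPattern) ℓ → Pred (∃ Permutation′) (lsuc 0ℓ ⊔ ℓ)
Av S (n , ρ) = ∀ {k} {p : MeshPattern k} → (k , p) ∈ S → Avoids ρ p

CoincidentUnder : ∀ {k₁ k₂} →
  Permutation′ l → MeshPattern k₁ → MeshPattern k₂ → Set₁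
CoincidentUnder π p₁ p₂ =
  Av (｛ _ , classical π ｝ ∪ ｛ _ , p₁ ｝) ≐ Av (｛ _ , classical π ｝ ∪ ｛ _ , p₂ ｝)

-- insert i j σ puts a new point with 0-based position i and 0-based
-- value j, shifting the points to its right and those above it by one.
-- The first insertion takes 0-based position a and value b; the second
-- one goes immediately to its right, above it for an ascent and below
-- it for a descent (which pushes the first one up to value b + 1).
insertAscent insertDescent : Permutation′ k → Box k → Permutation′ (2 ℕ.+ k)
insertAscent  σ (a , b) = insert (suc a) (suc b)     (insert a b σ)
insertDescent σ (a , b) = insert (suc a) (inject₁ b) (insert a b σ)

-- For a box (a , b) having a point of the pattern as a corner, (a′ , b′)
-- is the box diagonally opposite to it at that corner.
ShadingCondition : Pred (Box k) 0ℓ → Box k → Box k → Set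
ShadingCondition R (a , b) (a′ , b′) =
  (a′ , b′) ∉ R ×
  (∀ x → x ≢ a → x ≢ a′ → (x , b′) ∈ R → (x , b) ∈ R) ×
  (∀ y → y ≢ b → y ≢ b′ → (a′ , y) ∈ R → (a , y) ∈ R)

-- In each of these the point (i , j) of σ is the named corner of the box
-- (a , b).  In 1-based coordinates that point is (a+1 , b), (a , b+1),
-- (a+1 , b+1) and (a , b) respectively, and the opposite box is
-- (a+1 , b-1), (a-1 , b+1), (a+1 , b+1) and (a-1 , b-1).
LowerRightCondition UpperLeftCondition UpperRightCondition LowerLeftCondition :
  Permutation′ k → Pred (Box k) 0ℓ → Box k → Set
LowerRightCondition σ R (a , b) = ∃₂ λ i j →
  a ≡ inject₁ i × b ≡ suc j × (i , j) ∈ Plot σ ×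
  ShadingCondition R (a , b) (suc i , inject₁ j)
UpperLeftCondition σ R (a , b) = ∃₂ λ i j →
  a ≡ suc i × b ≡ inject₁ j × (i , j) ∈ Plot σ ×
  ShadingCondition R (a , b) (inject₁ i , suc j)
UpperRightCondition σ R (a , b) = ∃₂ λ i j →
  a ≡ inject₁ i × b ≡ inject₁ j × (i , j) ∈ Plot σ ×
  ShadingCondition R (a , b) (suc i , suc j)
LowerLeftCondition σ R (a , b) = ∃₂ λ i j →
  a ≡ suc i × b ≡ suc j × (i , j) ∈ Plot σ ×
  ShadingCondition R (a , b) (inject₁ i , inject₁ j)

{-# OPTIONS --safe #-}

-- Only Av {π, m₂} ⊆ Av {π, m₁} has content.  Take an occurrence of m₁ in a
-- permutation ρ and let (i , j) be the given corner of the box (a , b).  If the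
-- region of (a , b) contains a point of ρ, take the one q farthest from that
-- corner horizontally.  Two points of the region in the order type of the
-- inserted pair would give a copy of π, so when ρ avoids π, q is also the
-- farthest vertically.  Replacing the image of (i , j) by q then empties the
-- region of (a , b), while the shading condition keeps the regions of R₁
-- empty; this is an occurrence of m₂.

module Submission where

open import Defs
open import Data.Fin.Base as Fin
  using (Fin; zero; suc; toℕ; inject₁; punchIn; punchOut)
open import Data.Fin.Induction using (<-wellFounded; >-wellFounded)
open import Data.Fin.Permutation
  using (Permutation′; _⟨$⟩ʳ_; _⟨$⟩ˡ_; insert; insert-punchIn; inverseʳ; inverseˡ)
open import Data.Fin.Properties
  using (_≟_; <-cmp; inject₁-injective; suc-injective; toℕ-inject₁;
         toℕ-fromℕ; toℕ<n; ≤∧≢⇒<; <⇒≢; punchIn-mono-≤; punchIn-punchOut)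
open import Data.Fin.Relation.Unary.Top using (view; view-inject₁; ‵fromℕ; ‵inject₁)
open import Data.Nat.Base as ℕ using (ℕ; _+_; _≤_)
import Data.Nat.Properties as ℕ
open import Data.Product.Base using (_×_; _,_; ∃; ∃₂)
open import Data.Sum.Base using (_⊎_; inj₁; inj₂)
open import Data.Vec.Functional using (insertAt; updateAt)
open import Data.Vec.Functional.Properties
  using (insertAt-lookup; insertAt-punchIn; updateAt-updates; updateAt-minimal)
open import Function.Base using (_∘_; const)
open import Function.Bundles using (module Equivalence; module Injection)
open import Function.Properties.Inverse using (↔⇒↣)
open import Induction.WellFounded using (Acc; acc; WellFounded)
open import Level using (0ℓ)
open import Relation.Binary.Core using (_Preserves_⟶_)
open import Relation.Binary.Definitions using (tri<; tri≈; tri>)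
open import Relation.Binary.PropositionalEquality
  using (_≡_; _≢_; refl; sym; trans; cong; subst; subst₂)
open import Relation.Nullary using (¬_; yes; no; contradiction)
open import Relation.Unary using (Pred; Empty; _∈_; _∉_; _⊆_; _≐_; _∪_; ｛_｝)

private
  variable
    k l m n : ℕ

-- Strictly monotone maps and order-preserving injections.

StrictlyMonotone : (Fin k → Fin n) → Set
StrictlyMonotone α = α Preserves Fin._<_ ⟶ Fin._<_

strict⇒≤ : {α : Fin k → Fin n} → StrictlyMonotone α → α Preserves Fin._≤_ ⟶ Fin._≤_
strict⇒≤ mono {i} {j} i≤j with i ≟ j
... | yes refl = ℕ.≤-refl
... | no i≢j   = ℕ.<⇒≤ (mono (≤∧≢⇒< i≤j i≢j))

strict⇒injection : {α : Fin k → Fin n} → StrictlyMonotone α → OrderPreservingInjection α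
strict⇒injection {α = α} mono = inj , strict⇒≤ mono
  where
  inj : ∀ {i j} → α i ≡ α j → i ≡ j
  inj {i} {j} eq with <-cmp i j
  ... | tri< i<j _ _ = contradiction eq (<⇒≢ (mono i<j))
  ... | tri≈ _ i≡j _ = i≡j
  ... | tri> _ _ j<i = contradiction (sym eq) (<⇒≢ (mono j<i))

injection⇒strict : {α : Fin k → Fin n} → OrderPreservingInjection α → StrictlyMonotone α
injection⇒strict (inj , mono) i<j = ≤∧≢⇒< (mono (ℕ.<⇒≤ i<j)) (<⇒≢ i<j ∘ inj)

-- Strips

extend-inject₁ : (α : Fin k → Fin n) (i : Fin k) →
                 extend α (suc (inject₁ i)) ≡ ℕ.suc (toℕ (α i))
extend-inject₁ α i rewrite view-inject₁ i = refl

-- Strip `c` lies between the points numbered `c` and `c + 1`. The 0-based index `i` has number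
-- `i + 1`, so the indices with `i < c` fall before the strip and those with `c ≤ i` after it.
strip-above : {α : Fin k → Fin n} → StrictlyMonotone α →
              ∀ {x} c {i} → x ∈ Strip α c → i Fin.< c → α i Fin.< x
strip-above {α = α} mono (suc j) {i} (lo , _) i<c =
  ℕ.≤-<-trans (strict⇒≤ mono (ℕ.s≤s⁻¹ i<c))
              (ℕ.s<s⁻¹ (subst (ℕ._< _) (extend-inject₁ α j) lo))

strip-below : {α : Fin k → Fin n} → StrictlyMonotone α →
              ∀ {x} c {i} → x ∈ Strip α c → c Fin.≤ i → x Fin.< α i
strip-below mono c {i} (_ , hi) c≤i with view c
... | ‵fromℕ     = contradiction (subst (ℕ._≤ toℕ i) (toℕ-fromℕ _) c≤i) (ℕ.<⇒≱ (toℕ<n i))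
... | ‵inject₁ j =
  ℕ.<-≤-trans (ℕ.s<s⁻¹ hi) (strict⇒≤ mono (subst (ℕ._≤ toℕ i) (toℕ-inject₁ j) c≤i))

value∉strip : {α : Fin k → Fin n} → StrictlyMonotone α → ∀ c i → α i ∉ Strip α c
value∉strip mono c i αi∈c with toℕ i ℕ.<? toℕ c
... | yes i<c = ℕ.<-irrefl refl (strip-above mono c αi∈c i<c)
... | no  i≮c = ℕ.<-irrefl refl (strip-below mono c αi∈c (ℕ.≮⇒≥ i≮c))

-- Occurrences as pairs of strictly monotone maps.

record Embedding (σ : Permutation′ k) (ρ : Permutation′ n) : Set where
  field
    α      : Fin k → Fin n
    β      : Fin k → Fin n
    α-mono : StrictlyMonotone α
    β-mono : StrictlyMonotone β
    -- The point set `ω` of an occurrence is the `PlotImage` of `α` and `β`; this equation places it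
    -- in the plot of `ρ`.
    compat : ∀ i → ρ ⟨$⟩ʳ α i ≡ β (σ ⟨$⟩ʳ i)

open Embedding

PointIn : {σ : Permutation′ k} {ρ : Permutation′ n} →
          Embedding σ ρ → Box k → Pred (Fin n) 0ℓ
PointIn {ρ = ρ} e (a , b) x = x ∈ Strip (α e) a × ρ ⟨$⟩ʳ x ∈ Strip (β e) b

AvoidsShading : {σ : Permutation′ k} {ρ : Permutation′ n} →
                Embedding σ ρ → Pred (Box k) 0ℓ → Set
AvoidsShading e R = ∀ {c} → c ∈ R → Empty (PointIn e c)

contains⇒embedding : {σ : Permutation′ k} {ρ : Permutation′ n} {R : Pred (Box k) 0ℓ} →
                     Contains ρ (mesh σ R) → ∃ λ (e : Embedding σ ρ) → AvoidsShading e R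
contains⇒embedding {σ = σ} (_ , ω⊆ρ , α , β , α-inj , β-inj , (_ , image⊆ω) , avoid) =
  record
    { α      = α
    ; β      = β
    ; α-mono = injection⇒strict α-inj
    ; β-mono = injection⇒strict β-inj
    ; compat = λ i → ω⊆ρ (image⊆ω (i , σ ⟨$⟩ʳ i , refl , refl))
    } , λ c∈R x region → avoid c∈R (x , _) (region , refl)

embedding⇒contains : {σ : Permutation′ k} {ρ : Permutation′ n} {R : Pred (Box k) 0ℓ}
                     (e : Embedding σ ρ) → AvoidsShading e R → Contains ρ (mesh σ R)
embedding⇒contains {σ = σ} e avoid =
  PlotImage σ (α e) (β e) , (λ { (i , _ , refl , refl) → compat e i }) ,
  α e , β e , strict⇒injection (α-mono e) , strict⇒injection (β-mono e) ,
  ((λ p → p) , (λ p → p)) , λ { c∈R (x , _) (region , refl) → avoid c∈R x region }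

⪯-embedding : {π : Permutation′ l} {τ : Permutation′ m} {ρ : Permutation′ n} →
              π ⪯ τ → Embedding τ ρ → Embedding π ρ
⪯-embedding {π = π} {τ} (f , f-inj , iso) e = record
  { α      = α e ∘ f
  ; β      = β e ∘ g
  ; α-mono = α-mono e ∘ injection⇒strict f-inj
  ; β-mono = β-mono e ∘ g-mono
  ; compat = λ i → trans (compat e (f i))
                         (cong (λ j → β e (τ ⟨$⟩ʳ f j)) (sym (inverseˡ π)))
  }
  where
  -- Containment provides only a map of positions. The map of values follows `j` back to its
  -- position in `π`, then to the selected position in `τ`, and takes the value there.
  g : Fin _ → Fin _
  g j = τ ⟨$⟩ʳ f (π ⟨$⟩ˡ j)
  g-mono : StrictlyMonotone g
  g-mono i<j = Equivalence.to (iso _ _)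
    (subst₂ Fin._<_ (sym (inverseʳ π)) (sym (inverseʳ π)) i<j)

-- Inserting a point

punchIn-cancel-< : ∀ a {i j : Fin k} → punchIn a i Fin.< punchIn a j → i Fin.< j
punchIn-cancel-< a {i} {j} lt = ℕ.≰⇒> (ℕ.<⇒≱ lt ∘ punchIn-mono-≤ a j i)

punchIn<⇒< : ∀ a (i : Fin k) → punchIn a i Fin.< a → i Fin.< a
punchIn<⇒< (suc a) zero    _  = ℕ.z<s
punchIn<⇒< (suc a) (suc i) lt = ℕ.s<s (punchIn<⇒< a i (ℕ.s<s⁻¹ lt))

<punchIn⇒≤ : ∀ a (i : Fin k) → a Fin.< punchIn a i → a Fin.≤ i
<punchIn⇒≤ zero    i       _  = ℕ.z≤n
<punchIn⇒≤ (suc a) (suc i) lt = ℕ.s≤s (<punchIn⇒≤ a i (ℕ.s<s⁻¹ lt))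

data PunchInView (a : Fin (ℕ.suc k)) : Fin (ℕ.suc k) → Set where
  hole    : PunchInView a a
  punched : ∀ i → PunchInView a (punchIn a i)

punchInView : (a i : Fin (ℕ.suc k)) → PunchInView a i
punchInView a i with a ≟ i
... | yes refl = hole
... | no a≢i   = subst (PunchInView a) (punchIn-punchOut a≢i) (punched (punchOut a≢i))

insertAt-mono : {α : Fin k → Fin n} → StrictlyMonotone α →
                ∀ {a x} → x ∈ Strip α a → StrictlyMonotone (insertAt α a x)
insertAt-mono {α = α} mono {a} {x} x∈a {i} {j} i<j with punchInView a i | punchInView a j
... | hole       | hole       = contradiction i<j (ℕ.<-irrefl refl)
... | hole       | punched j′
  rewrite insertAt-lookup α a x | insertAt-punchIn α a x j′ =
  strip-below mono a x∈a (<punchIn⇒≤ a j′ i<j)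
... | punched i′ | hole
  rewrite insertAt-lookup α a x | insertAt-punchIn α a x i′ =
  strip-above mono a x∈a (punchIn<⇒< a i′ i<j)
... | punched i′ | punched j′
  rewrite insertAt-punchIn α a x i′ | insertAt-punchIn α a x j′ =
  mono (punchIn-cancel-< a i<j)

insertAt-suc : (α : Fin k → Fin n) (i : Fin k) (x : Fin n) →
               insertAt α (inject₁ i) x (suc i) ≡ α i
insertAt-suc α zero    x = refl
insertAt-suc α (suc i) x = insertAt-suc (α ∘ suc) i x

insertAt-inject₁ : (α : Fin k → Fin n) (i : Fin k) (x : Fin n) →
                   insertAt α (suc i) x (inject₁ i) ≡ α i
insertAt-inject₁ α zero    x = refl
insertAt-inject₁ α (suc i) x = insertAt-inject₁ (α ∘ suc) i x

-- Inserting `x` cuts strip `a` into the strips `inject₁ a` and `suc a`. This lemma and the next two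
-- compute their bounds: `x` between them, the old bounds of strip `a` outside.
extend-insertAt : (α : Fin k → Fin n) (a : Fin (ℕ.suc k)) (x : Fin n) →
                  extend (insertAt α a x) (suc (inject₁ a)) ≡ ℕ.suc (toℕ x)
extend-insertAt α a x =
  trans (extend-inject₁ (insertAt α a x) a) (cong (ℕ.suc ∘ toℕ) (insertAt-lookup α a x))

extend-insertAt-above : (α : Fin k → Fin n) (a : Fin (ℕ.suc k)) (x : Fin n) →
                        extend (insertAt α a x) (suc (suc a)) ≡ extend α (suc a)
extend-insertAt-above α a x with view a
... | ‵fromℕ     = refl
... | ‵inject₁ i = cong (ℕ.suc ∘ toℕ) (insertAt-suc α i x)

extend-insertAt-below : (α : Fin k → Fin n) (a : Fin (ℕ.suc k)) (x : Fin n) →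
  extend (insertAt α a x) (inject₁ (inject₁ a)) ≡ extend α (inject₁ a)
extend-insertAt-below α zero    x = refl
extend-insertAt-below α (suc i) x =
  trans (extend-inject₁ (insertAt α (suc i) x) (inject₁ i))
        (trans (cong (ℕ.suc ∘ toℕ) (insertAt-inject₁ α i x)) (sym (extend-inject₁ α i)))

strip-insertAt-above : {α : Fin k → Fin n} {a : Fin (ℕ.suc k)} {x z : Fin n} →
  z ∈ Strip α a → x Fin.< z → z ∈ Strip (insertAt α a x) (suc a)
strip-insertAt-above {α = α} {a} {x} (_ , hi) x<z =
  subst (ℕ._< _) (sym (extend-insertAt α a x)) (ℕ.s<s x<z) ,
  subst (_ ℕ.<_) (sym (extend-insertAt-above α a x)) hi

strip-insertAt-below : {α : Fin k → Fin n} {a : Fin (ℕ.suc k)} {x z : Fin n} →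
  z ∈ Strip α a → z Fin.< x → z ∈ Strip (insertAt α a x) (inject₁ a)
strip-insertAt-below {α = α} {a} {x} (lo , _) z<x =
  subst (ℕ._< _) (sym (extend-insertAt-below α a x)) lo ,
  subst (_ ℕ.<_) (sym (extend-insertAt α a x)) (ℕ.s<s z<x)

insert-lookup : ∀ a b (σ : Permutation′ k) → insert a b σ ⟨$⟩ʳ a ≡ b
insert-lookup a b σ with a ≟ a
... | yes _  = refl
... | no a≢a = contradiction refl a≢a

insertPoint : {σ : Permutation′ k} {ρ : Permutation′ n} (e : Embedding σ ρ) →
              ∀ {a b x} → x ∈ PointIn e (a , b) → Embedding (insert a b σ) ρ
insertPoint {σ = σ} {ρ} e {a} {b} {x} (x∈a , y∈b) = record
  { α      = insertAt (α e) a x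
  ; β      = insertAt (β e) b (ρ ⟨$⟩ʳ x)
  ; α-mono = insertAt-mono (α-mono e) x∈a
  ; β-mono = insertAt-mono (β-mono e) y∈b
  ; compat = insertAt-compat
  }
  where
  insertAt-compat : ∀ i → ρ ⟨$⟩ʳ insertAt (α e) a x i ≡
                          insertAt (β e) b (ρ ⟨$⟩ʳ x) (insert a b σ ⟨$⟩ʳ i)
  insertAt-compat i with punchInView a i
  ... | hole rewrite insertAt-lookup (α e) a x | insert-lookup a b σ =
    sym (insertAt-lookup (β e) b (ρ ⟨$⟩ʳ x))
  ... | punched j
    rewrite insertAt-punchIn (α e) a x j | insert-punchIn a b σ j
          | insertAt-punchIn (β e) b (ρ ⟨$⟩ʳ x) (σ ⟨$⟩ʳ j) = compat e j

-- Once `x` is inserted, `z` lies to its right and above it, hence in the box `(suc a , suc b)` of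
-- the enlarged embedding, where `insertAscent` makes its second insertion. For a descent that box
-- is `(suc a , inject₁ b)`.
ascent-embedding : {σ : Permutation′ k} {ρ : Permutation′ n} (e : Embedding σ ρ) →
  ∀ {c x z} → x ∈ PointIn e c → z ∈ PointIn e c →
  x Fin.< z → ρ ⟨$⟩ʳ x Fin.< ρ ⟨$⟩ʳ z → Embedding (insertAscent σ c) ρ
ascent-embedding e x∈c (z∈a , w∈b) x<z y<w = insertPoint (insertPoint e x∈c)
  (strip-insertAt-above z∈a x<z , strip-insertAt-above w∈b y<w)

descent-embedding : {σ : Permutation′ k} {ρ : Permutation′ n} (e : Embedding σ ρ) →
  ∀ {c x z} → x ∈ PointIn e c → z ∈ PointIn e c →
  x Fin.< z → ρ ⟨$⟩ʳ z Fin.< ρ ⟨$⟩ʳ x → Embedding (insertDescent σ c) ρ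
descent-embedding e x∈c (z∈a , w∈b) x<z w<y = insertPoint (insertPoint e x∈c)
  (strip-insertAt-above z∈a x<z , strip-insertAt-below w∈b w<y)

-- Moving a point

-- One side per axis tells which corner of the box the pattern point is, so the four cases of the
-- theorem share one argument.
data Side : Set where
  before after : Side

opposite : Side → Side
opposite before = after
opposite after  = before

adjacent : Side → Fin k → Fin (ℕ.suc k)
adjacent before = inject₁
adjacent after  = suc

-- x ≺[ s ] z : going from the strip on side s of a line towards that line,
-- x comes first.
infix 4 _≺[_]_
_≺[_]_ : Fin n → Side → Fin n → Set
x ≺[ before ] z = x Fin.< z
x ≺[ after  ] z = x Fin.> z

≺-wellFounded : ∀ s → WellFounded {A = Fin n} _≺[ s ]_
≺-wellFounded before = <-wellFounded
≺-wellFounded after  = >-wellFounded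

suc≢inject₁ : (i : Fin k) → suc i ≢ inject₁ i
suc≢inject₁ (suc i) = suc≢inject₁ i ∘ suc-injective

adjacent≢opposite : ∀ s (i : Fin k) → adjacent s i ≢ adjacent (opposite s) i
adjacent≢opposite before i = suc≢inject₁ i ∘ sym
adjacent≢opposite after  i = suc≢inject₁ i

<⇒<adjacent : ∀ s {i j : Fin k} → j Fin.< i → j Fin.< adjacent s i
<⇒<adjacent before {i} j<i rewrite toℕ-inject₁ i = j<i
<⇒<adjacent after      j<i = ℕ.m<n⇒m<1+n j<i

<⇒adjacent≤ : ∀ s {i j : Fin k} → i Fin.< j → adjacent s i Fin.≤ j
<⇒adjacent≤ before {i} i<j rewrite toℕ-inject₁ i = ℕ.<⇒≤ i<j
<⇒adjacent≤ after      i<j = i<j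

infixl 6 _[_]≔_
_[_]≔_ : (Fin k → Fin n) → Fin k → Fin n → Fin k → Fin n
α [ i ]≔ x = updateAt α i (const x)

-- A strip adjacent to `i` lies between the images of the neighbours of `i`, so the image of `i` can
-- move into it without changing the order.
[]≔-mono : {α : Fin k → Fin n} → StrictlyMonotone α →
           ∀ s i {x} → x ∈ Strip α (adjacent s i) → StrictlyMonotone (α [ i ]≔ x)
[]≔-mono {α = α} mono s i {x} x∈ {j} {j′} j<j′ with j ≟ i | j′ ≟ i
... | yes refl | yes refl = contradiction j<j′ (ℕ.<-irrefl refl)
... | yes refl | no j′≢i
  rewrite updateAt-updates i {const x} α | updateAt-minimal j′ i {const x} α j′≢i =
  strip-below mono _ x∈ (<⇒adjacent≤ s j<j′)
... | no j≢i   | yes refl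
  rewrite updateAt-updates i {const x} α | updateAt-minimal j i {const x} α j≢i =
  strip-above mono _ x∈ (<⇒<adjacent s j<j′)
... | no j≢i   | no j′≢i
  rewrite updateAt-minimal j i {const x} α j≢i | updateAt-minimal j′ i {const x} α j′≢i =
  mono j<j′

module _ (α : Fin k → Fin n) (i : Fin k) (x : Fin n) where

  private
    α′ : Fin k → Fin n
    α′ = α [ i ]≔ x

  extend-≔ : extend α′ (suc (inject₁ i)) ≡ ℕ.suc (toℕ x)
  extend-≔ = trans (extend-inject₁ α′ i) (cong (ℕ.suc ∘ toℕ) (updateAt-updates i α))

  extend-≔-other : ∀ c → c ≢ suc (inject₁ i) → extend α′ c ≡ extend α c
  extend-≔-other zero    _   = refl
  extend-≔-other (suc c) c≢i with view c
  ... | ‵fromℕ     = refl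
  ... | ‵inject₁ j =
    cong (ℕ.suc ∘ toℕ) (updateAt-minimal j i α (c≢i ∘ cong (suc ∘ inject₁)))

  strip-≔-near : ∀ s {z} → z ∈ Strip α′ (adjacent s i) → z ≺[ s ] x
  strip-≔-near before (_ , hi) = ℕ.s<s⁻¹ (subst (_ ℕ.<_) extend-≔ hi)
  strip-≔-near after  (lo , _) = ℕ.s<s⁻¹ (subst (ℕ._< _) extend-≔ lo)

  -- Only the line through the image of `i` moves, and it moves into the strip on side `s`. That
  -- strip shrinks, the one on the opposite side grows, and all others keep their bounds.
  strip-≔-⊆ : ∀ s c → x ∈ Strip α (adjacent s i) →
              c ≢ adjacent (opposite s) i → Strip α′ c ⊆ Strip α c
  strip-≔-⊆ before c (_ , x<αi) c≢ {z} z∈@(lo , hi) =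
    subst (ℕ._< _) (extend-≔-other (inject₁ c) (c≢ ∘ inject₁-injective)) lo , hi′
    where
    hi′ : ℕ.suc (toℕ z) ℕ.< extend α (suc c)
    hi′ with c ≟ inject₁ i
    ... | yes refl = ℕ.<-trans (ℕ.s<s (strip-≔-near before z∈)) x<αi
    ... | no c≢i   = subst (_ ℕ.<_) (extend-≔-other (suc c) (c≢i ∘ suc-injective)) hi
  strip-≔-⊆ after c (αi<x , _) c≢ {z} z∈@(lo , hi) =
    lo′ , subst (_ ℕ.<_) (extend-≔-other (suc c) (c≢ ∘ suc-injective)) hi
    where
    lo′ : extend α (inject₁ c) ℕ.< ℕ.suc (toℕ z)
    lo′ with c ≟ suc i
    ... | yes refl = ℕ.<-trans αi<x (ℕ.s<s (strip-≔-near after z∈))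
    ... | no c≢i   =
      subst (ℕ._< _) (extend-≔-other (inject₁ c) (c≢i ∘ inject₁-injective)) lo

  -- The growing strip gains exactly the old line and the part of the near strip between that line
  -- and `x`.
  strip-≔-far : ∀ s {z} → x ∈ Strip α (adjacent s i) →
                z ∈ Strip α′ (adjacent (opposite s) i) →
                z ∈ Strip α (adjacent (opposite s) i) ⊎ z ≡ α i ⊎
                (z ∈ Strip α (adjacent s i) × x ≺[ s ] z)
  strip-≔-far before {z} (lo-x , _) (lo , hi) with <-cmp z (α i)
  ... | tri< z<αi _ _ = inj₂ (inj₂
    ((ℕ.<-trans lo-x x<z , subst (_ ℕ.<_) (sym (extend-inject₁ α i)) (ℕ.s<s z<αi)) ,
     ℕ.s<s⁻¹ x<z))
    where
    x<z : ℕ.suc (toℕ x) ℕ.< ℕ.suc (toℕ z)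
    x<z = subst (ℕ._< _) extend-≔ lo
  ... | tri≈ _ z≡αi _ = inj₂ (inj₁ z≡αi)
  ... | tri> _ _ αi<z = inj₁
    (subst (ℕ._< _) (sym (extend-inject₁ α i)) (ℕ.s<s αi<z) ,
     subst (_ ℕ.<_) (extend-≔-other (suc (suc i)) (suc≢inject₁ i ∘ suc-injective)) hi)
  strip-≔-far after {z} (_ , hi-x) (lo , hi) with <-cmp z (α i)
  ... | tri> _ _ αi<z = inj₂ (inj₂
    ((subst (ℕ._< _) (sym (extend-inject₁ α i)) (ℕ.s<s αi<z) , ℕ.<-trans z<x hi-x) ,
     ℕ.s<s⁻¹ z<x))
    where
    z<x : ℕ.suc (toℕ z) ℕ.< ℕ.suc (toℕ x)
    z<x = subst (_ ℕ.<_) extend-≔ hi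
  ... | tri≈ _ z≡αi _ = inj₂ (inj₁ z≡αi)
  ... | tri< z<αi _ _ = inj₁
    (subst (ℕ._< _)
       (extend-≔-other (inject₁ (inject₁ i)) (suc≢inject₁ i ∘ sym ∘ inject₁-injective)) lo ,
     subst (_ ℕ.<_) (sym (extend-inject₁ α i)) (ℕ.s<s z<αi))

⟨$⟩ʳ-injective : (σ : Permutation′ k) {i j : Fin k} → σ ⟨$⟩ʳ i ≡ σ ⟨$⟩ʳ j → i ≡ j
⟨$⟩ʳ-injective σ = Injection.injective (↔⇒↣ σ)

movePoint : {σ : Permutation′ k} {ρ : Permutation′ n} (e : Embedding σ ρ) →
            ∀ s t i {x} → x ∈ PointIn e (adjacent s i , adjacent t (σ ⟨$⟩ʳ i)) →
            Embedding σ ρ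
movePoint {σ = σ} {ρ} e s t i {x} (x∈a , y∈b) = record
  { α      = α e [ i ]≔ x
  ; β      = β e [ σ ⟨$⟩ʳ i ]≔ (ρ ⟨$⟩ʳ x)
  ; α-mono = []≔-mono (α-mono e) s i x∈a
  ; β-mono = []≔-mono (β-mono e) t (σ ⟨$⟩ʳ i) y∈b
  ; compat = ≔-compat
  }
  where
  ≔-compat : ∀ j → ρ ⟨$⟩ʳ (α e [ i ]≔ x) j ≡
                   (β e [ σ ⟨$⟩ʳ i ]≔ (ρ ⟨$⟩ʳ x)) (σ ⟨$⟩ʳ j)
  ≔-compat j with j ≟ i
  ... | yes refl rewrite updateAt-updates i {const x} (α e) =
    sym (updateAt-updates (σ ⟨$⟩ʳ i) (β e))
  ... | no j≢i rewrite updateAt-minimal j i {const x} (α e) j≢i =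
    trans (compat e j)
          (sym (updateAt-minimal (σ ⟨$⟩ʳ j) (σ ⟨$⟩ʳ i) (β e) (j≢i ∘ ⟨$⟩ʳ-injective σ)))

-- The shading lemma for one corner.

BadPair : {σ : Permutation′ k} {ρ : Permutation′ n} →
          Embedding σ ρ → Box k → Side → Side → Set
-- Of the two points, `x` is farther from the corner horizontally and `z` vertically. Without such a
-- pair, the horizontally farthest point is also the vertically farthest.
BadPair {ρ = ρ} e c s t = ∃₂ λ x z →
  x ∈ PointIn e c × z ∈ PointIn e c × x ≺[ s ] z × ρ ⟨$⟩ʳ z ≺[ t ] ρ ⟨$⟩ʳ x

module _ {σ : Permutation′ k} {ρ : Permutation′ n} {R : Pred (Box k) 0ℓ}
         (s t : Side) (i : Fin k) where

  private
    j : Fin k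
    j = σ ⟨$⟩ʳ i

    a b a° b° : Fin (ℕ.suc k)
    a  = adjacent s i
    b  = adjacent t j
    a° = adjacent (opposite s) i
    b° = adjacent (opposite t) j

  -- Only regions in column `a°` or row `b°` can grow. What they gain comes from column `a` or row
  -- `b`, where the shading condition puts the matching box in `R`, except for the box `(a , b)`
  -- itself; there the choice of `x` decides.
  movePoint-avoids : ShadingCondition R (a , b) (a° , b°) →
    (e : Embedding σ ρ) → AvoidsShading e R → ¬ BadPair e (a , b) s t →
    ∀ {x} (x∈ : x ∈ PointIn e (a , b)) →
    (∀ {z} → z ≺[ s ] x → z ∉ PointIn e (a , b)) →
    AvoidsShading (movePoint e s t i x∈) (R ∪ ｛ a , b ｝)
  movePoint-avoids (opp∉R , row , column) e avoid ¬bad {x} x∈@(x∈a , y∈b) minimal = avoid′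
    where
    e′ : Embedding σ ρ
    e′ = movePoint e s t i x∈

    horizontal-⊆ : ∀ {u} → u ≢ a° → Strip (α e′) u ⊆ Strip (α e) u
    horizontal-⊆ {u} = strip-≔-⊆ (α e) i x s u x∈a

    vertical-⊆ : ∀ {v} → v ≢ b° → Strip (β e′) v ⊆ Strip (β e) v
    vertical-⊆ {v} = strip-≔-⊆ (β e) j (ρ ⟨$⟩ʳ x) t v y∈b

    oppositeRow : ∀ {u z} → u ≢ a° → (u , b°) ∈ R → z ∉ PointIn e′ (u , b°)
    oppositeRow {u} {z} u≢a° c∈R (z∈ , w∈)
      with strip-≔-far (β e) j (ρ ⟨$⟩ʳ x) t y∈b w∈
    ... | inj₁ w∈b° = avoid c∈R z (horizontal-⊆ u≢a° z∈ , w∈b°)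
    -- Here `z` is the old image of `i`, whose position lies on a grid line and so in no strip.
    ... | inj₂ (inj₁ w≡βj) = value∉strip (α-mono e) u i
      (subst (_∈ Strip (α e) u)
             (⟨$⟩ʳ-injective ρ (trans w≡βj (sym (compat e i)))) (horizontal-⊆ u≢a° z∈))
    ... | inj₂ (inj₂ (w∈b , _)) with u ≟ a
    -- This `z` would be a point of the box horizontally farther from the corner than `x`.
    ...   | yes refl = minimal (strip-≔-near (α e) i x s z∈) (horizontal-⊆ u≢a° z∈ , w∈b)
    ...   | no u≢a   = avoid (row u u≢a u≢a° c∈R) z (horizontal-⊆ u≢a° z∈ , w∈b)

    oppositeColumn : ∀ {v z} → v ≢ b° → (a° , v) ∈ R → z ∉ PointIn e′ (a° , v)
    oppositeColumn {v} {z} v≢b° c∈R (z∈ , w∈) with strip-≔-far (α e) i x s x∈a z∈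
    ... | inj₁ z∈a° = avoid c∈R z (z∈a° , vertical-⊆ v≢b° w∈)
    ... | inj₂ (inj₁ refl) = value∉strip (β-mono e) v j
      (subst (_∈ Strip (β e) v) (compat e i) (vertical-⊆ v≢b° w∈))
    ... | inj₂ (inj₂ (z∈a , x≺z)) with v ≟ b
    -- Now `z` is horizontally nearer to the corner than `x`, so minimality does not exclude it; but
    -- it is vertically farther, which makes the pair bad.
    ...   | yes refl = ¬bad (x , z , x∈ , (z∈a , vertical-⊆ v≢b° w∈) , x≺z ,
                             strip-≔-near (β e) j (ρ ⟨$⟩ʳ x) t w∈)
    ...   | no v≢b   = avoid (column v v≢b v≢b° c∈R) z (z∈a , vertical-⊆ v≢b° w∈)

    avoid′ : AvoidsShading e′ (R ∪ ｛ a , b ｝)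
    avoid′ (inj₂ refl) z (z∈ , w∈) = minimal (strip-≔-near (α e) i x s z∈)
      (horizontal-⊆ (adjacent≢opposite s i) z∈ , vertical-⊆ (adjacent≢opposite t j) w∈)
    avoid′ {u , v} (inj₁ c∈R) z (z∈ , w∈) with u ≟ a° | v ≟ b°
    ... | yes refl | yes refl = opp∉R c∈R
    ... | yes refl | no v≢b°  = oppositeColumn v≢b° c∈R (z∈ , w∈)
    ... | no u≢a°  | yes refl = oppositeRow u≢a° c∈R (z∈ , w∈)
    ... | no u≢a°  | no v≢b°  = avoid c∈R z (horizontal-⊆ u≢a° z∈ , vertical-⊆ v≢b° w∈)

  -- If no occurrence existed, a farthest point of the box could not exist either, since moving to
  -- it would give one. By well-founded induction the box would be empty, and `e` itself would be an
  -- occurrence. The double negation is enough for avoidance and spares a search for the farthest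
  -- point.
  shading-lemma : ShadingCondition R (a , b) (a° , b°) →
    (e : Embedding σ ρ) → AvoidsShading e R → ¬ BadPair e (a , b) s t →
    ¬ ¬ (∃ λ (e′ : Embedding σ ρ) → AvoidsShading e′ (R ∪ ｛ a , b ｝))
  shading-lemma cond e avoid ¬bad ¬occ = ¬occ (e , avoid′)
    where
    -- The induction hypothesis at x says precisely that x is minimal.
    empty : ∀ x → Acc _≺[ s ]_ x → x ∉ PointIn e (a , b)
    empty x (acc rs) x∈ = ¬occ (movePoint e s t i x∈ ,
      movePoint-avoids cond e avoid ¬bad x∈ (λ z≺x → empty _ (rs z≺x)))

    avoid′ : AvoidsShading e (R ∪ ｛ a , b ｝)
    avoid′ (inj₁ c∈R)      = avoid c∈R
    avoid′ (inj₂ refl) x x∈ = empty x (≺-wellFounded s x) x∈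

-- The four corners and the coincidence.

badPair⇒ascent : {σ : Permutation′ k} {ρ : Permutation′ n} (e : Embedding σ ρ) →
  ∀ {c} s → BadPair e c s (opposite s) → Embedding (insertAscent σ c) ρ
badPair⇒ascent e before (_ , _ , x∈ , z∈ , lt , lt′) = ascent-embedding e x∈ z∈ lt lt′
-- On side `after` the farther point is the right one, so the two points swap roles.
badPair⇒ascent e after  (_ , _ , x∈ , z∈ , lt , lt′) = ascent-embedding e z∈ x∈ lt lt′

badPair⇒descent : {σ : Permutation′ k} {ρ : Permutation′ n} (e : Embedding σ ρ) →
  ∀ {c} s → BadPair e c s s → Embedding (insertDescent σ c) ρ
badPair⇒descent e before (_ , _ , x∈ , z∈ , lt , lt′) = descent-embedding e x∈ z∈ lt lt′
badPair⇒descent e after  (_ , _ , x∈ , z∈ , lt , lt′) = descent-embedding e z∈ x∈ lt lt′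

-- At a lower right or upper left corner a bad pair is an ascent, at the other two a descent. Either
-- way it yields the inserted permutation, and with it `π`, inside `ρ`.
coincidence-lemma : {σ : Permutation′ k} {π : Permutation′ l} {ρ : Permutation′ n}
  {R : Pred (Box k) 0ℓ} {c : Box k} →
  (π ⪯ insertAscent σ c × LowerRightCondition σ R c)
  ⊎ (π ⪯ insertAscent σ c × UpperLeftCondition σ R c)
  ⊎ (π ⪯ insertDescent σ c × UpperRightCondition σ R c)
  ⊎ (π ⪯ insertDescent σ c × LowerLeftCondition σ R c) →
  ¬ Embedding π ρ → (e : Embedding σ ρ) → AvoidsShading e R →
  ¬ ¬ (∃ λ (e′ : Embedding σ ρ) → AvoidsShading e′ (R ∪ ｛ c ｝))
coincidence-lemma (inj₁ (π⪯ , i , _ , refl , refl , refl , cond)) ¬π e avoid =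
  shading-lemma before after i cond e avoid (¬π ∘ ⪯-embedding π⪯ ∘ badPair⇒ascent e before)
coincidence-lemma (inj₂ (inj₁ (π⪯ , i , _ , refl , refl , refl , cond))) ¬π e avoid =
  shading-lemma after before i cond e avoid (¬π ∘ ⪯-embedding π⪯ ∘ badPair⇒ascent e after)
coincidence-lemma (inj₂ (inj₂ (inj₁ (π⪯ , i , _ , refl , refl , refl , cond)))) ¬π e avoid =
  shading-lemma before before i cond e avoid
    (¬π ∘ ⪯-embedding π⪯ ∘ badPair⇒descent e before)
coincidence-lemma (inj₂ (inj₂ (inj₂ (π⪯ , i , _ , refl , refl , refl , cond)))) ¬π e avoid =
  shading-lemma after after i cond e avoid (¬π ∘ ⪯-embedding π⪯ ∘ badPair⇒descent e after)

proposition3p8 : ∀ {n l : ℕ} (σ : Permutation′ n) (π : Permutation′ l)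
    (R₁ R₂ : Pred (Box n) 0ℓ) →
    l ≤ n + 2 →
    (∃ λ (c : Box n) →
    (R₂ ≐ R₁ ∪ ｛ c ｝) ×
    ( (π ⪯ insertAscent σ c × LowerRightCondition σ R₁ c)
    ⊎ (π ⪯ insertAscent σ c × UpperLeftCondition σ R₁ c)
    ⊎ (π ⪯ insertDescent σ c × UpperRightCondition σ R₁ c)
    ⊎ (π ⪯ insertDescent σ c × LowerLeftCondition σ R₁ c))) →
    CoincidentUnder π (mesh σ R₁) (mesh σ R₂)
proposition3p8 σ π R₁ R₂ _ (c , (R₂⊆ , ⊆R₂) , cases) =
  (λ {x} → Av₁⊆Av₂ {x}) , (λ {x} → Av₂⊆Av₁ {x})
  where
  Av₁⊆Av₂ : Av (｛ _ , classical π ｝ ∪ ｛ _ , mesh σ R₁ ｝) ⊆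
            Av (｛ _ , classical π ｝ ∪ ｛ _ , mesh σ R₂ ｝)
  Av₁⊆Av₂ av (inj₁ refl) = av (inj₁ refl)
  -- Unshading a box keeps every occurrence.
  Av₁⊆Av₂ {_ , ρ} av (inj₂ refl) occ with contains⇒embedding {σ = σ} {ρ} {R₂} occ
  ... | e , avoid = av (inj₂ refl)
    (embedding⇒contains {ρ = ρ} e (λ {d} d∈R₁ → avoid (⊆R₂ {d} (inj₁ d∈R₁))))

  Av₂⊆Av₁ : Av (｛ _ , classical π ｝ ∪ ｛ _ , mesh σ R₂ ｝) ⊆
            Av (｛ _ , classical π ｝ ∪ ｛ _ , mesh σ R₁ ｝)
  Av₂⊆Av₁ av (inj₁ refl) = av (inj₁ refl)
  Av₂⊆Av₁ {_ , ρ} av (inj₂ refl) occ with contains⇒embedding {σ = σ} {ρ} {R₁} occ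
  ... | e , avoid = coincidence-lemma {π = π} {R = R₁} {c} cases
    -- A classical pattern has no shaded box, so an embedding of `π` is already an occurrence.
    (λ eπ → av (inj₁ refl) (embedding⇒contains {ρ = ρ} eπ (λ ())))
    e avoid
    (λ (e′ , avoid′) → av (inj₂ refl)
      (embedding⇒contains {ρ = ρ} e′ (λ {d} d∈R₂ → avoid′ (R₂⊆ {d} d∈R₂))))
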